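{- Let $J_{WFS}$ be the set of justified arguments according to the well-founded argumentation semantics for normal logic programs, applied to extended logic programs by treating an explicitly negated atom $\neg L$ as unrelated to the positive atom $L$, i.e. $J_{WFS}:=J_{\mathsf{u}/\mathsf{u}}$. Then $J_{WFS}=J_{\mathsf{u}/\mathsf{u}}=J_{\mathsf{u}/\mathsf{su}}$; $J_{WFS}\supsetneq J_{\mathsf{d}/y}\supsetneq J_{\mathsf{a}/y}$ and $J_{WFS}\subsetneq J_{\mathsf{su}/y}$ for all notions of attack $y\in\{\mathsf{a},\mathsf{d},\mathsf{u},\mathsf{sa},\mathsf{su}\}$; and $J_{WFS}\subsetneq J_{\mathsf{u}/\mathsf{a}}=J_{\mathsf{u}/\mathsf{d}}=J_{\mathsf{u}/\mathsf{sa}}$. Here equalities and inclusions between these semantics mean equality, respectively inclusion, for every extended logic program, and $\subsetneq$ (resp. $\supsetneq$) means that inclusion holds for every program and is proper for at least one program.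
   Context: Programs. An objective literal is a (ground) atom $A$ or its explicit negation $\neg A$, with the convention $\neg\neg L=L$. A default literal is an expression $not\,L$ with $L$ an objective literal. An extended logic program is a possibly infinite set of (ground) rules $L_0\gets L_1,\dots,L_m,not\,L_{m+1},\dots,not\,L_{m+n}$ ($m,n\ge 0$), each $L_i$ an objective literal; $L_0$ is the head and the rest is the body. Arguments. An argument associated with $P$ is a finite sequence $[r_1,\dots,r_n]$ of rules of $P$ such that for every $i$ and every objective literal $L$ in the body of $r_i$ there is $k>i$ with $head(r_k)=L$. A subargument of $A$ is a subsequence of $A$ which is an argument. A conclusion of $A$ is the head of a rule in $A$; an assumption of $A$ is a default literal in the body of a rule of $A$. $A$ is minimal for $L$ if $L$ is a conclusion of $A$ and no proper subargument of $A$ has conclusion $L$; $A$ is minimal if it is minimal for some $L$. $\mathit{Args}_P$ is the set of minimal arguments associated with $P$. Attacks. A notion of attack $x$ assigns to each program $P$ a relation $x_P\subseteq\mathit{Args}_P\times\mathit{Args}_P$; set operations on notions of attack and the inverse $x^{ -1}$ are taken program by program. The specific notions are: $\mathsf{u}$ (undercuts): $(A_1,A_2)\in\mathsf{u}$ iff some objective $L$ is a conclusion of $A_1$ with $not\,L$ an assumption of $A_2$; $\mathsf{r}$ (rebuts): some objective $L$ is a conclusion of $A_1$ with $\neg L$ a conclusion of $A_2$; $\mathsf{a}=\mathsf{u}\cup\mathsf{r}$ (attacks); $\mathsf{d}=\mathsf{u}\cup(\mathsf{r}-\mathsf{u}^{ -1})$ (defeats); $\mathsf{sa}=(\mathsf{u}\cup\mathsf{r})-\mathsf{u}^{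 -1}$ (strongly attacks); $\mathsf{su}=\mathsf{u}-\mathsf{u}^{ -1}$ (strongly undercuts). Justified arguments. For notions of attack $x,y$, an argument $A$ is $x/y$-acceptable wrt. a set $S$ of arguments if for every $B$ with $(B,A)\in x$ there is $C\in S$ with $(C,B)\in y$. $F_{P,x/y}(S)=\{A\in\mathit{Args}_P : A\text{ is }x/y\text{ -acceptable wrt. }S\}$ for $S\subseteq\mathit{Args}_P$, and $J_{P,x/y}$ (written $J_{x/y}$) is the least fixpoint of the monotone operator $F_{P,x/y}$; its elements are the $x/y$-justified arguments. -}

module Defs where

open import Level using (0ℓ)
open import Data.Fin.Base using (Fin) renaming (_<_ to _<ᶠ_)
open import Data.List.Base using (List; length; lookup)
open import Data.List.Membership.Propositional using (_∈_)
open import Data.List.Relation.Binary.Sublist.Propositional using () renaming (_⊆_ to _⊑_)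
open import Data.List.Relation.Unary.All using (All)
open import Data.Product.Base using (Σ; ∃-syntax; _×_; _,_; proj₁)
open import Data.Sum.Base using (_⊎_)
open import Relation.Binary.Core using (Rel)
open import Relation.Binary.Definitions using (DecidableEquality)
open import Relation.Binary.PropositionalEquality using (_≡_; _≢_)
open import Relation.Nullary.Negation using (¬_)
open import Relation.Unary using (Pred; _⊆_; _⊂_; _≐_)

infix  30 ∼_ not_
infixl 7 _─_
infixl 6 _∪_
infix  9 _⁻¹
infix  4 _≑_ _⊊_ _⊋_

data ObjLit (Atom : Set) : Set where
  pos neg : Atom → ObjLit Atom

∼_ : ∀ {Atom} → ObjLit Atom → ObjLit Atom
∼ pos p = neg p
∼ neg p = pos p

data DefLit (Atom : Set) : Set where
  not_ : ObjLit Atom → DefLit Atom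

record Rule (Atom : Set) : Set where
  constructor _⟵_,_
  field
    head  : ObjLit Atom
    body⁺ : List (ObjLit Atom)
    body⁻ : List (DefLit Atom)

open Rule public

-- Each program carries its own set of ground atoms.  Ground atoms are finite
-- syntactic objects, so their equality is decidable; membership of a rule in
-- the (possibly infinite) program need not be.
record Program : Set₁ where
  field
    Atom  : Set
    _≟_   : DecidableEquality Atom
    rules : Pred (Rule Atom) 0ℓ

open Program public using (Atom; rules)

module _ (P : Program) where

  record IsArgument (A : List (Rule (Atom P))) : Set where
    field
      fromProgram : All (rules P) A
      supported   : ∀ (i : Fin (length A)) {L} → L ∈ body⁺ (lookup A i) →
                    ∃[ k ] i <ᶠ k × head (lookup A k) ≡ L

  Conclusion : List (Rule (Atom P)) → Pred (ObjLit (Atom P)) 0ℓ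
  Conclusion A L = ∃[ r ] r ∈ A × head r ≡ L

  Assumption : List (Rule (Atom P)) → Pred (DefLit (Atom P)) 0ℓ
  Assumption A D = ∃[ r ] r ∈ A × D ∈ body⁻ r

  Subargument : Rel (List (Rule (Atom P))) 0ℓ
  Subargument A′ A = A′ ⊑ A × IsArgument A′

  MinimalFor : ObjLit (Atom P) → Pred (List (Rule (Atom P))) 0ℓ
  MinimalFor L A =
    Conclusion A L ×
    (∀ A′ → Subargument A′ A → A′ ≢ A → ¬ Conclusion A′ L)

  Minimal : Pred (List (Rule (Atom P))) 0ℓ
  Minimal A = ∃[ L ] MinimalFor L A

  Args : Set
  Args = Σ (List (Rule (Atom P))) λ A → IsArgument A × Minimal A

Attack : Set₁
Attack = ∀ P → Rel (Args P) 0ℓ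

_∪_ _─_ : Attack → Attack → Attack
(x ∪ y) P A B = x P A B ⊎ y P A B
(x ─ y) P A B = x P A B × ¬ y P A B

_⁻¹ : Attack → Attack
(x ⁻¹) P A B = x P B A

u r a d sa su : Attack
u P A₁ A₂ = ∃[ L ] Conclusion P (proj₁ A₁) L × Assumption P (proj₁ A₂) (not L)
r P A₁ A₂ = ∃[ L ] Conclusion P (proj₁ A₁) L × Conclusion P (proj₁ A₂) (∼ L)
a  = u ∪ r
d  = u ∪ (r ─ u ⁻¹)
sa = (u ∪ r) ─ u ⁻¹
su = u ─ u ⁻¹

module _ (x y : Attack) (P : Program) where

  Acceptable : Pred (Args P) 0ℓ → Pred (Args P) 0ℓ
  Acceptable S A = ∀ B → x P B A → ∃[ C ] S C × y P C B

  F : Pred (Args P) 0ℓ → Pred (Args P) 0ℓ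
  F S = Acceptable S

  data J : Pred (Args P) 0ℓ where
    fold : F J ⊆ J

  -- With fold, these say that J is the least fixpoint of F.

  J-unfold : J ⊆ F J
  J-unfold (fold f) = f

  J-least : ∀ (S : Pred (Args P) 0ℓ) → F S ⊆ S → J ⊆ S
  J-least S closed (fold f) = closed λ B b →
    let C , j , c = f B b in C , J-least S closed j , c

Semantics : Set₁
Semantics = ∀ P → Pred (Args P) 0ℓ

-- The well-founded argumentation semantics sees only undercuts, i.e. it treats
-- ∼ L as unrelated to L.
J-WFS : Semantics
J-WFS = J u u

_≑_ _⊊_ _⊋_ : Semantics → Semantics → Set₁
s ≑ t = ∀ P → s P ≐ t P
s ⊊ t = (∀ P → s P ⊆ t P) × (∃[ P ] s P ⊂ t P)
s ⊋ t = t ⊊ s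

{-# OPTIONS --safe #-}

-- Enlarging the defence relation y of J x y to y′ ⊇ y gains nothing when every
-- defence available only in y′ is x-counterattacked by its target: a justified
-- defender must itself be defended against that target, by an argument justified
-- earlier, and this descent ends.  With antitonicity in x and monotonicity in y,
-- this gives every equality and inclusion.  Properness is witnessed by programs
-- over one atom.

module Submission where

open import Defs
open import Data.List.Base using (List; _∷_; [])
open import Data.List.Membership.Propositional using (_∈_; find; lose)
import Data.List.Membership.DecPropositional as DecMembership
open import Data.List.Relation.Binary.Sublist.Propositional using (_∷ʳ_; _∷_; [])
open import Data.List.Relation.Unary.All as All using (All; []; _∷_)
open import Data.List.Relation.Unary.Any using (Any; here; there; any?)
open import Data.Empty using (⊥-elim)
open import Data.Fin.Base using (zero)
open import Data.Product.Base using (∃-syntax; _×_; _,_; proj₁; proj₂)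
open import Data.Sum.Base using (inj₁; inj₂; [_,_]; map₂)
open import Data.Unit.Base using (⊤; tt)
import Data.Unit.Properties as Unit
open import Function.Base using (id; _∘_)
open import Relation.Binary.Definitions using (DecidableEquality; Decidable)
open import Relation.Binary.PropositionalEquality using (_≡_; refl; sym; subst; cong)
open import Relation.Nullary.Decidable using (yes; no; map′)
open import Relation.Nullary.Negation using (¬_)
open import Relation.Unary using (_⊆_)

infix 4 _≼_

_≼_ : Attack → Attack → Set₁
x ≼ y = ∀ P A B → x P A B → y P A B

≼-refl : ∀ {x} → x ≼ x
≼-refl _ _ _ = id

≼-trans : ∀ {x y z} → x ≼ y → y ≼ z → x ≼ z
≼-trans x≼y y≼z P A B = y≼z P A B ∘ x≼y P A B

J-mono : ∀ {x x′ y y′} → x′ ≼ x → y ≼ y′ → ∀ P → J x y P ⊆ J x′ y′ P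
J-mono x′≼x y≼y′ P {A} (fold f) = fold λ B b →
  let C , j , c = f B (x′≼x P B A b) in
  C , J-mono x′≼x y≼y′ P j , y≼y′ P C B c

module _ {x y y′ : Attack} (counter : y′ ≼ y ∪ x ⁻¹) where

  -- The second component strengthens the induction: `y`-defenders take over all targets of `C`. By
  -- `counter`, either `C` itself `y`-attacks `B`, or `B` `x`-attacks `C`; then the defender of `C`
  -- against `B` was justified earlier and also has `B` as a target, so the induction hypothesis
  -- applies to it.
  J-shrink-defence⁺ : ∀ {P C} → J x y′ P C →
    J x y P C × (∀ B → y′ P C B → ∃[ C′ ] J x y P C′ × y P C′ B)
  J-shrink-defence⁺ {P} {C} (fold f) =
    fold g , λ B c → [ (λ c′ → C , fold g , c′) , g B ] (counter P C B c)
    where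
    g : ∀ B → x P B C → ∃[ C′ ] J x y P C′ × y P C′ B
    g B b = let _ , j , c = f B b in proj₂ (J-shrink-defence⁺ j) B c

  J-shrink-defence : ∀ P → J x y′ P ⊆ J x y P
  J-shrink-defence P j = proj₁ (J-shrink-defence⁺ j)

-- A justified argument would need a defender justified before it, which is attacked in turn,
-- without end.
J-empty : ∀ {x y P} → (∀ A → ∃[ B ] x P B A) → ∀ {A} → ¬ J x y P A
J-empty attacked {A} (fold f) =
  let B , b = attacked A ; C , j , _ = f B b in J-empty attacked j

module _ {Atom : Set} (_≟_ : DecidableEquality Atom) where

  ObjLit-≟ : DecidableEquality (ObjLit Atom)
  ObjLit-≟ (pos p) (pos q) = map′ (cong pos) (λ { refl → refl }) (p ≟ q)
  ObjLit-≟ (pos _) (neg _) = no λ ()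
  ObjLit-≟ (neg _) (pos _) = no λ ()
  ObjLit-≟ (neg p) (neg q) = map′ (cong neg) (λ { refl → refl }) (p ≟ q)

  DefLit-≟ : DecidableEquality (DefLit Atom)
  DefLit-≟ (not K) (not L) = map′ (cong not_) (λ { refl → refl }) (ObjLit-≟ K L)

-- Arguments are finite lists, so a search suffices although program membership may be undecidable.
-- This lets the case splits on undercuts stay constructive.
u? : ∀ P → Decidable (u P)
u? P (A , _) (B , _) =
  map′ to from (any? (λ s → any? (λ t → not head s ∈? body⁻ t) B) A)
  where
  open DecMembership (DefLit-≟ (Program._≟_ P)) using (_∈?_)
  to : Any _ A → ∃[ L ] Conclusion P A L × Assumption P B (not L)
  to any = let s , s∈A , any′ = find any ; t , t∈B , n∈t = find any′ in
    head s , (s , s∈A , refl) , (t , t∈B , n∈t)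
  from : ∃[ L ] Conclusion P A L × Assumption P B (not L) → Any _ A
  from (_ , (s , s∈A , refl) , (t , t∈B , n∈t)) = lose s∈A (lose t∈B n∈t)

∼-involutive : ∀ {Atom} (L : ObjLit Atom) → ∼ ∼ L ≡ L
∼-involutive (pos _) = refl
∼-involutive (neg _) = refl

r-sym : ∀ {P A B} → r P A B → r P B A
r-sym {P} {A} (L , A⊢L , B⊢∼L) =
  ∼ L , B⊢∼L , subst (Conclusion P (proj₁ A)) (sym (∼-involutive L)) A⊢L

u≼d : u ≼ d
u≼d _ _ _ = inj₁

u≼a : u ≼ a
u≼a _ _ _ = inj₁

d≼a : d ≼ a
d≼a _ _ _ = map₂ proj₁

sa≼d : sa ≼ d
sa≼d _ _ _ (c , ¬b) = map₂ (_, ¬b) c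

su≼sa : su ≼ sa
su≼sa _ _ _ (c , ¬b) = inj₁ c , ¬b

su≼u : su ≼ u
su≼u _ _ _ = proj₁

-- Taking `u ⁻¹` for `y` gives the `counter` premise that shrinks `u` to `su` and `a` to `sa`.
≼-─∪ : ∀ {x y} → (∀ P → Decidable (y P)) → x ≼ (x ─ y) ∪ y
≼-─∪ y? P A B c with y? P A B
... | yes b = inj₂ b
... | no ¬b = inj₁ (c , ¬b)

u⁻¹? : ∀ P → Decidable ((u ⁻¹) P)
u⁻¹? P A B = u? P B A

-- Rebutting is symmetric, so a rebut without an accompanying undercut is, reversed, a defeat.
a≼u∪d⁻¹ : a ≼ u ∪ d ⁻¹
a≼u∪d⁻¹ _ _ _ (inj₁ c) = inj₁ c
a≼u∪d⁻¹ P C B (inj₂ c) with u? P C B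
... | yes c′ = inj₁ c′
... | no ¬c′ = inj₂ (inj₂ (r-sym {P} {C} {B} c , ¬c′))

notions : List Attack
notions = a ∷ d ∷ u ∷ sa ∷ su ∷ []

notions-between : All (λ y → su ≼ y × y ≼ a) notions
notions-between =
    (≼-trans su≼u u≼a , ≼-refl)
  ∷ (≼-trans su≼u u≼d , d≼a)
  ∷ (su≼u , u≼a)
  ∷ (su≼sa , ≼-trans sa≼d d≼a)
  ∷ (≼-refl , ≼-trans su≼u u≼a)
  ∷ []

J-uu⊆J-usu : ∀ P → J u u P ⊆ J u su P
J-uu⊆J-usu = J-shrink-defence (≼-─∪ u⁻¹?)

J-ua⊆J-usa : ∀ P → J u a P ⊆ J u sa P
J-ua⊆J-usa = J-shrink-defence (≼-─∪ u⁻¹?)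

J-da⊆J-du : ∀ P → J d a P ⊆ J d u P
J-da⊆J-du = J-shrink-defence a≼u∪d⁻¹

module _ (P : Program) where

  singleton : ∀ {L D} → rules P (L ⟵ [] , D) → Args P
  singleton {L} {D} ρ =
    (L ⟵ [] , D) ∷ [] ,
    record { fromProgram = ρ ∷ [] ; supported = λ { zero () } } ,
    L , (_ , here refl , refl) ,
    λ { _ (refl ∷ [] , _) A′≢A _ → A′≢A refl
      ; _ (_ ∷ʳ [] , _) _ (_ , () , _) }

  fact-not-undercut : ∀ {L} (ρ : rules P (L ⟵ [] , [])) B → ¬ u P B (singleton ρ)
  fact-not-undercut ρ B (_ , _ , _ , here refl , ())

  conclusionOf : (A : Args P) → ∃[ L ] Conclusion P (proj₁ A) L
  conclusionOf (_ , _ , L , c , _) = L , c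

  ruleIn : ∀ (A : Args P) {ρ} → ρ ∈ proj₁ A → rules P ρ
  ruleIn (_ , isArg , _) = All.lookup (IsArgument.fromProgram isArg)

program : List (Rule ⊤) → Program
program ρs = record { Atom = ⊤ ; _≟_ = Unit._≟_ ; rules = _∈ ρs }

p ¬p : ObjLit ⊤
p  = pos tt
¬p = neg tt

-- Over one atom every conclusion is `p` or `¬p`, and the one-rule argument for the opposite literal
-- rebuts it.
rebutted : ∀ {ρs D D′} → (p ⟵ [] , D) ∈ ρs → (¬p ⟵ [] , D′) ∈ ρs →
           ∀ A → ∃[ B ] r (program ρs) B A
rebutted {ρs} ρ ρ′ A with conclusionOf (program ρs) A
... | pos tt , c = singleton (program ρs) ρ′ , ¬p , (_ , here refl , refl) , c
... | neg tt , c = singleton (program ρs) ρ  , p  , (_ , here refl , refl) , c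

-- Without undercuts everything is in `J-WFS`, while every rebut is a defeat and so every argument
-- is defeated.
contradictoryFacts : Program
contradictoryFacts = program ((p ⟵ [] , []) ∷ (¬p ⟵ [] , []) ∷ [])

module _ where
  private P = contradictoryFacts

  no-undercuts : ∀ A B → ¬ u P A B
  no-undercuts A B (_ , _ , _ , ρ∈B , n∈ρ) with ruleIn P B ρ∈B | n∈ρ
  ... | here refl         | ()
  ... | there (here refl) | ()

  J-WFS⊈J-d : ∀ y → ¬ (J-WFS P ⊆ J d y P)
  J-WFS⊈J-d y J-WFS⊆J-d =
    J-empty {d} {y} {P} attacked (J-WFS⊆J-d {A} (fold λ B b → ⊥-elim (no-undercuts B A b)))
    where
    A = singleton P (here refl)
    attacked : ∀ A → ∃[ B ] d P B A
    attacked A = let B , b = rebutted (here refl) (there (here refl)) A in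
      B , inj₂ (b , no-undercuts A B)

-- The fact `p` undercuts every argument that rebuts it, so it is never defeated; yet every argument
-- is attacked by a rebut.
defeasibleNegation : Program
defeasibleNegation = program ((p ⟵ [] , []) ∷ (¬p ⟵ [] , (not p ∷ [])) ∷ [])

module _ where
  private P = defeasibleNegation

  J-d⊈J-a : ∀ y → ¬ (J d y P ⊆ J a y P)
  J-d⊈J-a y J-d⊆J-a =
    J-empty {a} {y} {P} attacked (J-d⊆J-a {A} (fold λ B b → ⊥-elim (not-defeated B b)))
    where
    A = singleton P (here refl)
    attacked : ∀ A → ∃[ B ] a P B A
    attacked A = let B , b = rebutted (here refl) (there (here refl)) A in B , inj₂ b
    not-defeated : ∀ B → ¬ d P B A
    not-defeated B (inj₁ b) = fact-not-undercut P (here refl) B b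
    not-defeated B (inj₂ ((pos tt , _ , _ , here refl , ()) , _))
    not-defeated B (inj₂ ((neg tt , (ρ , ρ∈B , h) , _) , n)) with ruleIn P B ρ∈B | h
    ... | here refl         | ()
    ... | there (here refl) | _ = n (p , (_ , here refl , refl) , (ρ , ρ∈B , here refl))

-- All undercuts are mutual, hence none is strong, and every argument is undercut.
selfUndercut : Program
selfUndercut = program ((p ⟵ [] , (not p ∷ [])) ∷ [])

module _ where
  private P = selfUndercut

  J-su⊈J-WFS : ∀ y → ¬ (J su y P ⊆ J-WFS P)
  J-su⊈J-WFS y J-su⊆J-WFS =
    J-empty {u} {u} {P} attacked (J-su⊆J-WFS {A} (fold λ B b → ⊥-elim (counter B b)))
    where
    A = singleton P (here refl)
    attacked : ∀ B → ∃[ C ] u P C B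
    attacked B@(_ , _ , _ , (_ , ρ∈B , _) , _) with ruleIn P B ρ∈B
    ... | here refl = A , p , (_ , here refl , refl) , (_ , ρ∈B , here refl)
    counter : ∀ B → ¬ su P B A
    counter B ((_ , (_ , ρ∈B , _) , _) , n) with ruleIn P B ρ∈B
    ... | here refl = n (p , (_ , here refl , refl) , (_ , ρ∈B , here refl))

-- The fact `p` undercuts the argument from `not p`. No undercut can answer a fact, but the fact
-- `¬p`, itself never undercut, rebuts it.
rebuttedUndercut : Program
rebuttedUndercut = program ((p ⟵ [] , []) ∷ (¬p ⟵ [] , []) ∷ (p ⟵ [] , (not p ∷ [])) ∷ [])

module _ where
  private P = rebuttedUndercut

  J-ua⊈J-WFS : ¬ (J u a P ⊆ J-WFS P)
  J-ua⊈J-WFS J-ua⊆J-WFS = not-justified (J-ua⊆J-WFS {A} (fold defended))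
    where
    A B C : Args P
    A = singleton P (there (there (here refl)))
    B = singleton P (here refl)
    C = singleton P (there (here refl))
    defended : ∀ B → u P B A → ∃[ C ] J u a P C × a P C B
    defended B (_ , B⊢p , _ , here refl , here refl) =
      C , fold (λ B b → ⊥-elim (fact-not-undercut P (there (here refl)) B b)) ,
      inj₂ (¬p , (_ , here refl , refl) , B⊢p)
    not-justified : ¬ J-WFS P A
    not-justified (fold f) =
      let C , _ , c = f B (p , (_ , here refl , refl) , (_ , here refl , here refl)) in
      fact-not-undercut P (here refl) C c

corollary12 : (J-WFS ≑ J u u × J u u ≑ J u su) ×
    (∀ y → y ∈ (a ∷ d ∷ u ∷ sa ∷ su ∷ []) →
    (J-WFS ⊋ J d y × J d y ⊋ J a y) × J-WFS ⊊ J su y) ×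
    (J-WFS ⊊ J u a × J u a ≑ J u d × J u d ≑ J u sa)
corollary12 =
  ((λ _ → id , id) , λ P → J-uu⊆J-usu P , J-mono ≼-refl su≼u P) ,
  (λ y y∈ → let su≼y , y≼a = All.lookup notions-between y∈ in
    -- The chain is `J d y ⊆ J d a ⊆ J d u ⊆ J u u`.
    (strict (λ P → J-mono u≼d ≼-refl P ∘ J-da⊆J-du P ∘ J-mono ≼-refl y≼a P) (J-WFS⊈J-d y) ,
     strict (J-mono d≼a ≼-refl) (J-d⊈J-a y)) ,
    -- Here `J u u ⊆ J u su ⊆ J su y`.
    strict (λ P → J-mono su≼u su≼y P ∘ J-uu⊆J-usu P) (J-su⊈J-WFS y)) ,
  strict (J-mono ≼-refl u≼a) J-ua⊈J-WFS ,
  (λ P → J-mono ≼-refl sa≼d P ∘ J-ua⊆J-usa P , J-mono ≼-refl d≼a P) ,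
  λ P → J-ua⊆J-usa P ∘ J-mono ≼-refl d≼a P , J-mono ≼-refl sa≼d P
  where
  strict : ∀ {s t P} → (∀ P → s P ⊆ t P) → ¬ (t P ⊆ s P) → s ⊊ t
  strict {P = P} s⊆t t⊈s = s⊆t , P , s⊆t P , t⊈s
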